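{- Let $k$ be a nonnegative integer and let $n$ be a positive integer. Then $$ s(n,k)=(-1)^{n+k}(n-1)!\sum_{\substack{\mu\in\mathcal P^{*}\\ \ell(\mu)=k-1\\ \mu_1<n}}\pi(\mu)^{ -1} =(-1)^{n+k}\sum_{\substack{\mu\in\mathcal P^{*}\\ \ell(\mu)=n-k\\ \mu_1<n}}\pi(\mu), $$ where the first sum is over all linear partitions $\mu$ with exactly $k-1$ parts, all of which are distinct and less than $n$, and the second sum is over all linear partitions $\mu$ with exactly $n-k$ parts, all of which are distinct and less than $n$.
   Context: For a positive integer $n$, $(y)_n=y(y-1)\cdots(y-n+1)$, and the Stirling number of the first kind $s(n,k)$ of degree $n$ and order $k\ge0$ is the coefficient of $y^k$ in $(y)_n$. A linear partition is a nonincreasing infinite sequence $\mu=(\mu_i)_{i\ge1}$ of nonnegative integers that is eventually zero. The nonzero $\mu_i$ are the parts of $\mu$, $\ell(\mu)$ is the number of parts, and $\pi(\mu)$ is the product of the parts. $\mathcal P^{*}$ is the set of all linear partitions whose parts are pairwise distinct. The zero sequence is a linear partition (with distinct parts) having no parts, and the product of its parts is $1$. There are no partitions with a negative number of parts, so a sum over such partitions is $0$. -}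

module Defs where

open import Data.Nat as ℕ using (ℕ; zero; suc; NonZero; _≤_; _<_)
open import Data.Nat.Properties using (nonZero?)
open import Data.Nat.ListAction using (product)
open import Data.Nat.ListAction.Properties using (product≢0)
open import Data.Integer as ℤ using (ℤ; +_; 0ℤ; 1ℤ)
open import Data.Rational as ℚ using (ℚ; 0ℚ)
open import Data.List using (List; []; _∷_; map; foldr; filter; length; applyUpTo)
open import Data.List.Relation.Unary.All using (All)
open import Data.List.Relation.Unary.All.Properties using (all-filter)
import Data.List.Relation.Unary.Unique.Propositional as Propositional
import Data.List.Relation.Unary.Unique.Setoid as UniqueSetoid
import Data.List.Membership.Setoid as MembershipSetoid
open import Data.Product using (∃-syntax; _×_; proj₁)
open import Level using (0ℓ)
open import Relation.Binary using (Setoid)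
import Relation.Binary.Construct.On as On
open import Relation.Binary.PropositionalEquality using (_≡_; _→-setoid_)

-- Integer polynomials in one variable y, as lists of coefficients starting
-- with the constant term; trailing zeros are allowed.

Poly : Set
Poly = List ℤ

coefficient : Poly → ℕ → ℤ
coefficient []      _       = 0ℤ
coefficient (a ∷ _) zero    = a
coefficient (_ ∷ p) (suc k) = coefficient p k

infixl 6 _⊕_
infixl 7 _⊗_

_⊕_ : Poly → Poly → Poly
[]      ⊕ q       = q
(a ∷ p) ⊕ []      = a ∷ p
(a ∷ p) ⊕ (b ∷ q) = (a ℤ.+ b) ∷ (p ⊕ q)

_⊗_ : Poly → Poly → Poly
[]      ⊗ q = []
(a ∷ p) ⊗ q = map (a ℤ.*_) q ⊕ (0ℤ ∷ (p ⊗ q))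

y : Poly
y = 0ℤ ∷ 1ℤ ∷ []

const : ℤ → Poly
const a = a ∷ []

-- fallingFactorial n = (y)ₙ = y (y - 1) ⋯ (y - n + 1)
fallingFactorial : ℕ → Poly
fallingFactorial zero    = const 1ℤ
fallingFactorial (suc n) = fallingFactorial n ⊗ (y ⊕ const (ℤ.- (+ n)))

-- Stirling numbers of the first kind (signed).
s : ℕ → ℕ → ℤ
s n k = coefficient (fallingFactorial n) k

-- Indices are shifted by one: part μ i is μᵢ₊₁.
record LinearPartition : Set where
  field
    part           : ℕ → ℕ
    nonincreasing  : ∀ i → part (suc i) ≤ part i
    eventuallyZero : ∃[ N ] (∀ i → N ≤ i → part i ≡ 0)

open LinearPartition public

-- The nonzero entries, with multiplicity.  Entries from the recorded bound
-- on are zero, so the result does not depend on the choice of that bound.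
parts : LinearPartition → List ℕ
parts μ = filter nonZero? (applyUpTo (part μ) (proj₁ (eventuallyZero μ)))

ℓ : LinearPartition → ℕ
ℓ μ = length (parts μ)

π : LinearPartition → ℕ
π μ = product (parts μ)

π≢0 : ∀ μ → NonZero (π μ)
π≢0 μ = product≢0
  (all-filter nonZero? (applyUpTo (part μ) (proj₁ (eventuallyZero μ))))

πℚ : LinearPartition → ℚ
πℚ μ = + π μ ℚ./ 1

π⁻¹ : LinearPartition → ℚ
π⁻¹ μ = (+ 1 ℚ./ π μ) {{π≢0 μ}}

DistinctParts : LinearPartition → Set
DistinctParts μ = Propositional.Unique (parts μ)

-- Partitions with exactly m parts, all distinct and less than n.  The number
-- of parts m is an integer; for negative m there are no such partitions.
DistinctBelow : (m : ℤ) (n : ℕ) → LinearPartition → Set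
DistinctBelow m n μ = DistinctParts μ × + ℓ μ ≡ m × part μ 0 < n

-- Two partitions are equal when they are equal as sequences.
≈-setoid : Setoid 0ℓ 0ℓ
≈-setoid = On.setoid (ℕ →-setoid ℕ) part

open UniqueSetoid ≈-setoid using (Unique)
open MembershipSetoid ≈-setoid using (_∈_)

-- μs lists every partition satisfying P exactly once, and no others.
Enumerates : (LinearPartition → Set) → List LinearPartition → Set
Enumerates P μs = All P μs × Unique μs × (∀ μ → P μ → μ ∈ μs)

sum : List ℚ → ℚ
sum = foldr ℚ._+_ 0ℚ

-- IsSum P f S: the set of partitions satisfying P is finite, and the sum of
-- f over it is S, in whatever order the set is enumerated.  There is an
-- enumeration, so P and f determine S.
IsSum : (LinearPartition → Set) → (LinearPartition → ℚ) → ℚ → Set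
IsSum P f S =
  (∃[ μs ] Enumerates P μs) ×
  (∀ μs → Enumerates P μs → sum (map f μs) ≡ S)

fromℤ : ℤ → ℚ
fromℤ a = a ℚ./ 1

-- (-1)ᵐ
sign : ℕ → ℚ
sign m = fromℤ ((ℤ.- 1ℤ) ℤ.^ m)

{-# OPTIONS --safe #-}

-- Split the partitions with j distinct parts, all at most m + 1, according to
-- whether m + 1 is a part.  This turns the sums of π μ and of m! π(μ)⁻¹ into
-- recurrences in m.  Comparing the coefficients in (y)ₙ₊₁ = (y)ₙ (y - n) gives
-- c(n+1, k+1) = c(n, k) + n c(n, k+1) for c(n, k) = (-1)ⁿ⁺ᵏ s(n, k), and this
-- recurrence is satisfied by both sums.  As IsSum quantifies over all
-- enumerations, one also needs that any two duplicate-free lists with the same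
-- members are permutations of each other.
module Submission where

open import Defs
open import Data.Nat using (ℕ; NonZero; _+_; _∸_; _!)
open import Data.Integer as ℤ using (+_)
open import Data.Rational using (_*_)
open import Data.Product using (∃-syntax; _×_)
open import Relation.Binary.PropositionalEquality using (_≡_)

open import Data.Nat as ℕ using (zero; suc; _≤_; _<_; _⊔_; z≤n; s≤s; s≤s⁻¹)
import Data.Nat.Properties as ℕₚ
open import Data.Nat.ListAction using (product)
import Data.Nat.Solver as ℕSolver
open import Data.Integer using (0ℤ; 1ℤ)
import Data.Integer.Properties as ℤₚ
import Data.Integer.Solver as ℤSolver
open import Data.Rational as ℚ using (ℚ; 0ℚ; fromℚᵘ; toℚᵘ)
import Data.Rational.Properties as ℚₚ
import Data.Rational.Solver as ℚSolver
open import Data.Rational.Unnormalised as ℚᵘ using (mkℚᵘ; *≡*)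
import Data.Rational.Unnormalised.Properties as ℚᵘₚ
open import Data.Empty using (⊥-elim)
open import Data.List using (List; []; _∷_; _++_; map; filter; length; applyUpTo)
open import Data.List.Properties using (map-++; map-∘)
open import Data.List.Relation.Unary.All as All using (All; []; _∷_)
import Data.List.Relation.Unary.All.Properties as Allₚ
open import Data.List.Relation.Unary.AllPairs using ([]; _∷_)
import Data.List.Relation.Unary.AllPairs.Properties as AllPairsₚ
open import Data.List.Relation.Unary.Any using (here; there)
import Data.List.Relation.Unary.Unique.Propositional as Propositional
import Data.List.Relation.Unary.Unique.Setoid as UniqueSetoid
import Data.List.Relation.Unary.Unique.Setoid.Properties as Uniqueₚ
import Data.List.Membership.Setoid as MembershipSetoid
import Data.List.Membership.Setoid.Properties as Membershipₚ
import Data.List.Relation.Binary.Permutation.Setoid as PermutationSetoid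
import Data.List.Relation.Binary.Permutation.Setoid.Properties as Permutationₚ
open import Data.Product using (_,_; proj₁; proj₂)
open import Function using (_∘_)
open import Relation.Binary using (Setoid)
open import Relation.Binary.PropositionalEquality
  using (_≢_; _≗_; refl; sym; trans; cong; cong₂; subst; setoid; module ≡-Reasoning)
open import Relation.Nullary using (¬_; yes; no; contradiction)

-- Duplicate-free lists over a setoid

module _ {a r} (S : Setoid a r) where

  open Setoid S using (_≈_) renaming (sym to ≈-sym; trans to ≈-trans)
  open UniqueSetoid S using (Unique)
  open MembershipSetoid S using (_∈_)
  open PermutationSetoid S

  -- Induction on `xs`: an element equivalent to the head occurs in `ys` and can be moved to its
  -- front. Since neither list repeats its head, the remainders again have the same members.
  unique∧set⇒↭ : ∀ {xs ys} → Unique xs → Unique ys →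
    (∀ z → z ∈ xs → z ∈ ys) → (∀ z → z ∈ ys → z ∈ xs) → xs ↭ ys
  unique∧set⇒↭ {[]} {[]} _ _ _ _ = ↭-refl
  unique∧set⇒↭ {[]} {y ∷ ys} _ _ _ ys⊆ with () ← ys⊆ _ (here (Setoid.refl S))
  unique∧set⇒↭ {x ∷ xs} {ys} xxs!@(_ ∷ xs!) ys! xs⊆ ys⊆
    with as , bs , w , x≈w , ys≋ ← Membershipₚ.∈-∃++ S (xs⊆ _ (here (Setoid.refl S)))
    = ↭-trans (↭-prep x (unique∧set⇒↭ xs! zs! xs⊆zs zs⊆xs)) (↭-sym ys↭)
    where
    ys↭ : ys ↭ x ∷ as ++ bs
    ys↭ = ↭-trans (↭-reflexive-≋ ys≋) (Permutationₚ.shift S (≈-sym x≈w) as bs)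

    xzs! : Unique (x ∷ as ++ bs)
    xzs! = Permutationₚ.Unique-resp-↭ S ys↭ ys!

    zs! : Unique (as ++ bs)
    zs! with _ ∷ p ← xzs! = p

    xs⊆zs : ∀ z → z ∈ xs → z ∈ as ++ bs
    xs⊆zs z z∈xs with Permutationₚ.∈-resp-↭ S ys↭ (xs⊆ z (there z∈xs))
    ... | here z≈x = contradiction (Membershipₚ.∈-resp-≈ S z≈x z∈xs)
                       (Uniqueₚ.Unique[x∷xs]⇒x∉xs S xxs!)
    ... | there z∈zs = z∈zs

    zs⊆xs : ∀ z → z ∈ as ++ bs → z ∈ xs
    zs⊆xs z z∈zs with ys⊆ z (Permutationₚ.∈-resp-↭ S (↭-sym ys↭) (there z∈zs))
    ... | here z≈x = contradiction (Membershipₚ.∈-resp-≈ S z≈x z∈zs)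
                       (Uniqueₚ.Unique[x∷xs]⇒x∉xs S xzs!)
    ... | there z∈xs = z∈xs

-- Sums over enumerations

open Setoid ≈-setoid using (_≈_)
open UniqueSetoid ≈-setoid using (Unique)
open MembershipSetoid ≈-setoid using (_∈_)

-- One enumeration suffices: any other is a permutation of it, and addition is commutative. `f` has
-- to respect `≈` because two enumerations may represent the same sequence with different recorded
-- bounds.
enumerates⇒isSum : ∀ {P f μs} → (∀ {μ ν} → μ ≈ ν → f μ ≡ f ν) →
  Enumerates P μs → IsSum P f (sum (map f μs))
enumerates⇒isSum {P} {f} {μs} f-cong e@(all , μs! , complete) =
  (μs , e) , λ where
    νs (all′ , νs! , complete′) →
      Permutationₚ.foldr-commMonoid (setoid ℚ) ℚₚ.+-0-isCommutativeMonoid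
        (Permutationₚ.map⁺ ≈-setoid (setoid ℚ) f-cong
          (unique∧set⇒↭ ≈-setoid νs! μs!
            (moves all′ complete) (moves all complete′)))
  where
  moves : ∀ {κs λs} → All P κs → (∀ μ → P μ → μ ∈ λs) → ∀ z → z ∈ κs → z ∈ λs
  -- `P` is not assumed to respect `≈`, so completeness is applied to the listed `κ` and the
  -- membership is then transported to `z`.
  moves {κ ∷ _} (p ∷ _) c z (here z≈κ) =
    Membershipₚ.∈-resp-≈ ≈-setoid {x = κ} {y = z} (λ i → sym (z≈κ i)) (c κ p)
  moves (_ ∷ ps) c z (there z∈) = moves ps c z z∈

isSum-empty : ∀ {P f} → (∀ μ → ¬ P μ) → IsSum P f 0ℚ
isSum-empty none = ([] , [] , [] , λ μ p → ⊥-elim (none μ p)) , λ where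
  []      _             → refl
  (μ ∷ _) (p ∷ _ , _)  → ⊥-elim (none μ p)

-- Partitions with distinct parts

-- Separates the sequence from its bound, so that one can induct on the bound while shifting the
-- sequence; `parts μ` is an instance by definition.
nonzeros : (ℕ → ℕ) → ℕ → List ℕ
nonzeros f N = filter ℕₚ.nonZero? (applyUpTo f N)

ZeroFrom : ℕ → (ℕ → ℕ) → Set
ZeroFrom N f = ∀ i → N ≤ i → f i ≡ 0

-- The bounds may differ: entries of one sequence beyond the bound of the other are zero and get
-- filtered out.
nonzeros-cong : ∀ {f g} N M → f ≗ g → ZeroFrom N f → ZeroFrom M g →
  nonzeros f N ≡ nonzeros g M
nonzeros-cong zero    zero    f≗g f0 g0 = refl
nonzeros-cong zero    (suc M) f≗g f0 g0
  rewrite sym (f≗g 0) | f0 0 z≤n =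
  nonzeros-cong zero M (f≗g ∘ suc) (λ i _ → f0 (suc i) z≤n) (λ i M≤i → g0 (suc i) (s≤s M≤i))
nonzeros-cong (suc N) zero    f≗g f0 g0
  rewrite f≗g 0 | g0 0 z≤n =
  nonzeros-cong N zero (f≗g ∘ suc) (λ i N≤i → f0 (suc i) (s≤s N≤i)) (λ i _ → g0 (suc i) z≤n)
nonzeros-cong {f} {g} (suc N) (suc M) f≗g f0 g0
  with ih ← nonzeros-cong N M (f≗g ∘ suc) (λ i N≤i → f0 (suc i) (s≤s N≤i)) (λ i M≤i → g0 (suc i) (s≤s M≤i))
  rewrite f≗g 0 with g 0
... | zero  = ih
... | suc a = cong (suc a ∷_) ih

parts-cong : ∀ {μ ν} → μ ≈ ν → parts μ ≡ parts ν
parts-cong {μ} {ν} μ≈ν = nonzeros-cong _ _ μ≈ν (proj₂ (eventuallyZero μ)) (proj₂ (eventuallyZero ν))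

tail : LinearPartition → LinearPartition
tail μ .part i = part μ (suc i)
tail μ .nonincreasing i = nonincreasing μ (suc i)
tail μ .eventuallyZero =
  let N , zeros = eventuallyZero μ in N , λ i N≤i → zeros (suc i) (ℕₚ.m≤n⇒m≤1+n N≤i)

empty : LinearPartition
empty .part _ = 0
empty .nonincreasing _ = z≤n
empty .eventuallyZero = 0 , λ _ _ → refl

-- The maximum makes this total; it is only applied with part μ 0 ≤ a.
prepend : ℕ → LinearPartition → LinearPartition
prepend a μ .part zero = a ⊔ part μ 0
prepend a μ .part (suc i) = part μ i
prepend a μ .nonincreasing zero = ℕₚ.m≤n⊔m a (part μ 0)
prepend a μ .nonincreasing (suc i) = nonincreasing μ i
prepend a μ .eventuallyZero =
  let N , zeros = eventuallyZero μ in suc N , λ { (suc i) (s≤s N≤i) → zeros i N≤i }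

part≤part₀ : ∀ μ i → part μ i ≤ part μ 0
part≤part₀ μ zero    = ℕₚ.≤-refl
part≤part₀ μ (suc i) = ℕₚ.≤-trans (nonincreasing μ i) (part≤part₀ μ i)

parts≤part₀ : ∀ μ → All (_≤ part μ 0) (parts μ)
parts≤part₀ μ = Allₚ.filter⁺ ℕₚ.nonZero? 
  (Allₚ.applyUpTo⁺₂ (part μ) (proj₁ (eventuallyZero μ)) (part≤part₀ μ))

part₀≡0⇒≈empty : ∀ μ → part μ 0 ≡ 0 → μ ≈ empty
part₀≡0⇒≈empty μ eq i = ℕₚ.n≤0⇒n≡0 (subst (part μ i ≤_) eq (part≤part₀ μ i))

parts-uncons : ∀ {μ a} → part μ 0 ≡ suc a → parts μ ≡ suc a ∷ parts (tail μ)
parts-uncons {μ} {a} eq = begin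
  -- The bound is raised to `suc N` so that splitting off one entry leaves `N`, the bound recorded
  -- by `tail μ`.
  parts μ                         ≡⟨ nonzeros-cong _ (suc N) (λ _ → refl) zeros
                                       (λ i N<i → zeros i (ℕₚ.<⇒≤ N<i)) ⟩
  nonzeros (part μ) (suc N)       ≡⟨ step ⟩
  suc a ∷ parts (tail μ)          ∎
  where
  open ≡-Reasoning
  N = proj₁ (eventuallyZero μ)
  zeros = proj₂ (eventuallyZero μ)
  step : nonzeros (part μ) (suc N) ≡ suc a ∷ parts (tail μ)
  step rewrite eq = refl

parts-prepend : ∀ {m μ} → part μ 0 ≤ suc m → parts (prepend (suc m) μ) ≡ suc m ∷ parts μ
parts-prepend {m} {μ} μ₀≤ rewrite ℕₚ.m≥n⇒m⊔n≡m μ₀≤ = refl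

-- `m` bounds the parts inclusively and `j` counts them, so the property enumerated is
-- `DistinctBelow (+ j) (suc m)`.
distinct≤ : ℕ → ℕ → List LinearPartition
distinct≤ m       zero    = empty ∷ []
distinct≤ zero    (suc j) = []
distinct≤ (suc m) (suc j) = map (prepend (suc m)) (distinct≤ m j) ++ distinct≤ m (suc j)

distinct≤-sound : ∀ m j → All (DistinctBelow (+ j) (suc m)) (distinct≤ m j)
distinct≤-sound m       zero    = ([] , refl , s≤s z≤n) ∷ []
distinct≤-sound zero    (suc j) = []
distinct≤-sound (suc m) (suc j) = Allₚ.++⁺
  (Allₚ.map⁺ (All.map (λ {μ} → withTop μ) (distinct≤-sound m j)))
  (All.map (λ (d , l , b) → d , l , ℕₚ.m≤n⇒m≤1+n b) (distinct≤-sound m (suc j)))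
  where
  withTop : ∀ μ → DistinctBelow (+ j) (suc m) μ →
    DistinctBelow (+ suc j) (suc (suc m)) (prepend (suc m) μ)
  withTop μ (d , l , s≤s b)
    rewrite parts-prepend {m} {μ} (ℕₚ.m≤n⇒m≤1+n b)
          | ℕₚ.m≥n⇒m⊔n≡m (ℕₚ.m≤n⇒m≤1+n b) =
      -- Every part of `μ` is at most `m`, so the new part `suc m` differs from all of them.
      All.map (λ p≤ eq → ℕₚ.<-irrefl (sym eq) (s≤s (ℕₚ.≤-trans p≤ b))) (parts≤part₀ μ) ∷ d
    , cong (ℤ._+_ (+ 1)) l
    , ℕₚ.≤-refl

distinct≤-unique : ∀ m j → Unique (distinct≤ m j)
distinct≤-unique m       zero    = [] ∷ []
distinct≤-unique zero    (suc j) = []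
distinct≤-unique (suc m) (suc j) = AllPairsₚ.++⁺
  -- Dropping the first entry undoes `prepend (suc m)`, so prepending is injective up to `≈`.
  (Uniqueₚ.map⁺ ≈-setoid ≈-setoid (λ eq → eq ∘ suc) (distinct≤-unique m j))
  (distinct≤-unique m (suc j))
  -- The two halves are disjoint: first entries are at least `suc m` in one and below `suc m` in the
  -- other.
  (Allₚ.map⁺ (All.universal (λ μ →
    All.map (λ {ν} (_ , _ , b) eq →
        ℕₚ.<⇒≱ b (subst (suc m ≤_) (eq 0) (ℕₚ.m≤m⊔n (suc m) (part μ 0))))
      (distinct≤-sound m (suc j))) (distinct≤ m j)))

distinct≤-complete : ∀ m j μ → DistinctBelow (+ j) (suc m) μ → μ ∈ distinct≤ m j
distinct≤-complete m zero μ (_ , l , _) with part μ 0 in eq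
... | zero = here (part₀≡0⇒≈empty μ eq)
... | suc a with () ← trans (sym (cong length (parts-uncons {μ} eq))) (ℤₚ.+-injective l)
distinct≤-complete zero (suc j) μ (_ , l , b)
  with () ← trans (sym (ℤₚ.+-injective l))
              (cong length (parts-cong {μ} {empty} (part₀≡0⇒≈empty μ (ℕₚ.n≤0⇒n≡0 (s≤s⁻¹ b)))))
-- As the sequence is nonincreasing and bounded by `suc m`, its first entry decides whether `suc m`
-- is a part.
distinct≤-complete (suc m) (suc j) μ (d , l , s≤s b) with part μ 0 ℕ.≟ suc m
... | no  μ₀≢ = Membershipₚ.∈-++⁺ʳ ≈-setoid {μ} (map (prepend (suc m)) (distinct≤ m j))
                  (distinct≤-complete m (suc j) μ (d , l , ℕₚ.≤∧≢⇒< b μ₀≢))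
... | yes μ₀≡ = Membershipₚ.∈-++⁺ˡ ≈-setoid {μ}
    (Membershipₚ.∈-resp-≈ ≈-setoid {x = prepend (suc m) (tail μ)} {y = μ} (λ i → sym (μ≈ i))
      (Membershipₚ.∈-map⁺ ≈-setoid ≈-setoid {f = prepend (suc m)}
        (λ {μ} {ν} → prepend-cong {μ} {ν}) {v = tail μ}
        (distinct≤-complete m j (tail μ) tail-distinct)))
  where
  prepend-cong : ∀ {μ ν} → μ ≈ ν → prepend (suc m) μ ≈ prepend (suc m) ν
  prepend-cong eq zero    = cong (suc m ⊔_) (eq 0)
  prepend-cong eq (suc i) = eq i

  μ≈ : μ ≈ prepend (suc m) (tail μ)
  μ≈ zero = trans μ₀≡ (sym (ℕₚ.m≥n⇒m⊔n≡m (ℕₚ.≤-trans (nonincreasing μ 0) b)))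
  μ≈ (suc i) = refl

  parts≡ : parts μ ≡ suc m ∷ parts (tail μ)
  parts≡ = parts-uncons {μ} μ₀≡

  tail-distinct : DistinctBelow (+ j) (suc m) (tail μ)
  tail-distinct with m∉ ∷ tail! ← subst Propositional.Unique parts≡ d =
      tail!
    , cong +_ (ℕₚ.suc-injective (trans (cong length (sym parts≡)) (ℤₚ.+-injective l)))
    -- Monotonicity alone allows a second entry equal to `suc m`; that would repeat the part `suc m`
    -- in `μ`.
    , ℕₚ.≤∧≢⇒< (ℕₚ.≤-trans (nonincreasing μ 0) b) λ eq →
        contradiction refl (All.head (subst (All (suc m ≢_)) (parts-uncons {tail μ} eq) m∉))

distinct≤-enumerates : ∀ m j → Enumerates (DistinctBelow (+ j) (suc m)) (distinct≤ m j)
distinct≤-enumerates m j = distinct≤-sound m j , distinct≤-unique m j , distinct≤-complete m j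

πℚ-cong : ∀ {μ ν} → μ ≈ ν → πℚ μ ≡ πℚ ν
πℚ-cong {μ} {ν} μ≈ν rewrite parts-cong {μ} {ν} μ≈ν = refl

π⁻¹-cong : ∀ {μ ν} → μ ≈ ν → π⁻¹ μ ≡ π⁻¹ ν
π⁻¹-cong {μ} {ν} μ≈ν = ℚₚ./-cong {+ 1} {π μ} {+ 1} {π ν} {{π≢0 μ}} {{π≢0 ν}} refl
  (cong product (parts-cong {μ} {ν} μ≈ν))


-- Unsigned Stirling numbers

coefficient-⊕ : ∀ p q k → coefficient (p ⊕ q) k ≡ coefficient p k ℤ.+ coefficient q k
coefficient-⊕ []      q       k       = sym (ℤₚ.+-identityˡ _)
coefficient-⊕ (a ∷ p) []      k       = sym (ℤₚ.+-identityʳ _)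
coefficient-⊕ (a ∷ p) (b ∷ q) zero    = refl
coefficient-⊕ (a ∷ p) (b ∷ q) (suc k) = coefficient-⊕ p q k

coefficient-map-* : ∀ a q k → coefficient (map (a ℤ.*_) q) k ≡ a ℤ.* coefficient q k
coefficient-map-* a []      k       = sym (ℤₚ.*-zeroʳ a)
coefficient-map-* a (b ∷ q) zero    = refl
coefficient-map-* a (b ∷ q) (suc k) = coefficient-map-* a q k

coefficient-∷-⊗ : ∀ a p q k →
  coefficient ((a ∷ p) ⊗ q) k ≡ a ℤ.* coefficient q k ℤ.+ coefficient (0ℤ ∷ p ⊗ q) k
coefficient-∷-⊗ a p q k = trans (coefficient-⊕ (map (a ℤ.*_) q) (0ℤ ∷ p ⊗ q) k)
  (cong (ℤ._+ coefficient (0ℤ ∷ p ⊗ q) k) (coefficient-map-* a q k))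

coefficient-⊗-linear-zero : ∀ p b →
  coefficient (p ⊗ (y ⊕ const b)) 0 ≡ b ℤ.* coefficient p 0
coefficient-⊗-linear-zero []      b = sym (ℤₚ.*-zeroʳ b)
coefficient-⊗-linear-zero (a ∷ p) b = trans (coefficient-∷-⊗ a p (y ⊕ const b) 0)
  (solve 2 (λ a b → a :* (con 0ℤ :+ b) :+ con 0ℤ := b :* a) refl a b)
  where open ℤSolver.+-*-Solver

-- Multiplication by `y` shifts the coefficients and multiplication by `b` scales them. The
-- induction follows the recursion of `⊗` on its left factor and ends in the constant-term case.
coefficient-⊗-linear-suc : ∀ p b k →
  coefficient (p ⊗ (y ⊕ const b)) (suc k) ≡ coefficient p k ℤ.+ b ℤ.* coefficient p (suc k)
coefficient-⊗-linear-suc []      b k = sym (trans (ℤₚ.+-identityˡ _) (ℤₚ.*-zeroʳ b))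
coefficient-⊗-linear-suc (a ∷ p) b zero = begin
  coefficient ((a ∷ p) ⊗ (y ⊕ const b)) 1
    ≡⟨ coefficient-∷-⊗ a p (y ⊕ const b) 1 ⟩
  a ℤ.* 1ℤ ℤ.+ coefficient (p ⊗ (y ⊕ const b)) 0
    ≡⟨ cong₂ ℤ._+_ (ℤₚ.*-identityʳ a) (coefficient-⊗-linear-zero p b) ⟩
  a ℤ.+ b ℤ.* coefficient p 0 ∎
  where open ≡-Reasoning
coefficient-⊗-linear-suc (a ∷ p) b (suc k) = begin
  coefficient ((a ∷ p) ⊗ (y ⊕ const b)) (suc (suc k))
    ≡⟨ coefficient-∷-⊗ a p (y ⊕ const b) (suc (suc k)) ⟩
  a ℤ.* 0ℤ ℤ.+ coefficient (p ⊗ (y ⊕ const b)) (suc k)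
    ≡⟨ cong (ℤ._+ coefficient (p ⊗ (y ⊕ const b)) (suc k)) (ℤₚ.*-zeroʳ a) ⟩
  0ℤ ℤ.+ coefficient (p ⊗ (y ⊕ const b)) (suc k)
    ≡⟨ ℤₚ.+-identityˡ _ ⟩
  coefficient (p ⊗ (y ⊕ const b)) (suc k)
    ≡⟨ coefficient-⊗-linear-suc p b k ⟩
  coefficient p k ℤ.+ b ℤ.* coefficient p (suc k) ∎
  where open ≡-Reasoning

-- Given by the recurrence for c(n, k) instead of as an absolute value, for direct comparison with
-- the recurrences of the sums.
∣s∣ : ℕ → ℕ → ℕ
∣s∣ zero    zero    = 1
∣s∣ zero    (suc k) = 0
∣s∣ (suc n) zero    = n ℕ.* ∣s∣ n zero
∣s∣ (suc n) (suc k) = ∣s∣ n k + n ℕ.* ∣s∣ n (suc k)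

-- In the recurrence, raising both indices changes the sign twice, and raising `n` alone changes it
-- once, which the factor -n compensates.
s≡±∣s∣ : ∀ n k → s n k ≡ (ℤ.- 1ℤ) ℤ.^ (n + k) ℤ.* + ∣s∣ n k
s≡±∣s∣ zero    zero    = refl
s≡±∣s∣ zero    (suc k) = sym (ℤₚ.*-zeroʳ ((ℤ.- 1ℤ) ℤ.^ suc k))
s≡±∣s∣ (suc n) zero    = begin
  s (suc n) 0
    ≡⟨ coefficient-⊗-linear-zero (fallingFactorial n) (ℤ.- (+ n)) ⟩
  ℤ.- (+ n) ℤ.* s n 0
    ≡⟨ cong (ℤ.- (+ n) ℤ.*_) (s≡±∣s∣ n 0) ⟩
  ℤ.- (+ n) ℤ.* ((ℤ.- 1ℤ) ℤ.^ (n + 0) ℤ.* + ∣s∣ n 0)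
    ≡⟨ solve 3 (λ n e u → :- n :* (e :* u) := (:- con 1ℤ :* e) :* (n :* u)) refl
         (+ n) ((ℤ.- 1ℤ) ℤ.^ (n + 0)) (+ ∣s∣ n 0) ⟩
  (ℤ.- 1ℤ) ℤ.^ (suc n + 0) ℤ.* (+ n ℤ.* + ∣s∣ n 0)
    ≡⟨ cong ((ℤ.- 1ℤ) ℤ.^ (suc n + 0) ℤ.*_) (sym (ℤₚ.pos-* n (∣s∣ n 0))) ⟩
  (ℤ.- 1ℤ) ℤ.^ (suc n + 0) ℤ.* + ∣s∣ (suc n) 0 ∎
  where
  open ≡-Reasoning
  open ℤSolver.+-*-Solver
s≡±∣s∣ (suc n) (suc k) = begin
  s (suc n) (suc k)
    ≡⟨ coefficient-⊗-linear-suc (fallingFactorial n) (ℤ.- (+ n)) k ⟩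
  s n k ℤ.+ ℤ.- (+ n) ℤ.* s n (suc k)
    ≡⟨ cong₂ (λ a b → a ℤ.+ ℤ.- (+ n) ℤ.* b) (s≡±∣s∣ n k) (s≡±∣s∣ n (suc k)) ⟩
  (ℤ.- 1ℤ) ℤ.^ (n + k) ℤ.* + ∣s∣ n k ℤ.+
    ℤ.- (+ n) ℤ.* ((ℤ.- 1ℤ) ℤ.^ (n + suc k) ℤ.* + ∣s∣ n (suc k))
    ≡⟨ cong (λ j → (ℤ.- 1ℤ) ℤ.^ (n + k) ℤ.* + ∣s∣ n k ℤ.+
             ℤ.- (+ n) ℤ.* ((ℤ.- 1ℤ) ℤ.^ j ℤ.* + ∣s∣ n (suc k))) (ℕₚ.+-suc n k) ⟩
  (ℤ.- 1ℤ) ℤ.^ (n + k) ℤ.* + ∣s∣ n k ℤ.+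
    ℤ.- (+ n) ℤ.* ((ℤ.- 1ℤ) ℤ.^ suc (n + k) ℤ.* + ∣s∣ n (suc k))
    ≡⟨ solve 4 (λ n e u v → e :* u :+ :- n :* ((:- con 1ℤ :* e) :* v)
                 := (:- con 1ℤ :* (:- con 1ℤ :* e)) :* (u :+ n :* v)) refl
         (+ n) ((ℤ.- 1ℤ) ℤ.^ (n + k)) (+ ∣s∣ n k) (+ ∣s∣ n (suc k)) ⟩
  (ℤ.- 1ℤ) ℤ.^ suc (suc (n + k)) ℤ.* (+ ∣s∣ n k ℤ.+ + n ℤ.* + ∣s∣ n (suc k))
    ≡⟨ cong₂ (λ j a → (ℤ.- 1ℤ) ℤ.^ j ℤ.* (+ ∣s∣ n k ℤ.+ a))
         (cong suc (sym (ℕₚ.+-suc n k))) (sym (ℤₚ.pos-* n (∣s∣ n (suc k)))) ⟩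
  (ℤ.- 1ℤ) ℤ.^ (suc n + suc k) ℤ.* + ∣s∣ (suc n) (suc k) ∎
  where
  open ≡-Reasoning
  open ℤSolver.+-*-Solver

∣s∣≡0 : ∀ {n k} → n < k → ∣s∣ n k ≡ 0
∣s∣≡0 {zero}  {suc k} _ = refl
∣s∣≡0 {suc n} {suc k} (s≤s n<k)
  rewrite ∣s∣≡0 n<k | ∣s∣≡0 (ℕₚ.m≤n⇒m≤1+n n<k) = ℕₚ.*-zeroʳ n

∣s∣[n,n]≡1 : ∀ n → ∣s∣ n n ≡ 1
∣s∣[n,n]≡1 zero = refl
∣s∣[n,n]≡1 (suc n)
  rewrite ∣s∣[n,n]≡1 n | ∣s∣≡0 (ℕₚ.n<1+n n) = cong suc (ℕₚ.*-zeroʳ n)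

-- This reflects that y divides (y)ₙ₊₁.
∣s∣[1+n,0]≡0 : ∀ n → ∣s∣ (suc n) 0 ≡ 0
∣s∣[1+n,0]≡0 zero    = refl
∣s∣[1+n,0]≡0 (suc n) rewrite ∣s∣[1+n,0]≡0 n = ℕₚ.*-zeroʳ (suc n)

∣s∣[1+n,1]≡n! : ∀ n → ∣s∣ (suc n) 1 ≡ n !
∣s∣[1+n,1]≡n! zero = refl
∣s∣[1+n,1]≡n! (suc n) = cong₂ (λ a b → a + suc n ℕ.* b) (∣s∣[1+n,0]≡0 n) (∣s∣[1+n,1]≡n! n)

-- e m j is the elementary symmetric polynomial of degree j at 1, …, m.
e : ℕ → ℕ → ℕ
e m       zero    = 1
e zero    (suc j) = 0
e (suc m) (suc j) = suc m ℕ.* e m j + e m (suc j)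

e≡0 : ∀ {m j} → m < j → e m j ≡ 0
e≡0 {zero}  {suc j} _ = refl
e≡0 {suc m} {suc j} (s≤s m<j)
  rewrite e≡0 m<j | e≡0 (ℕₚ.m≤n⇒m≤1+n m<j) = trans (ℕₚ.+-identityʳ _) (ℕₚ.*-zeroʳ (suc m))

-- Both sides obey the same recurrence, with the summands in opposite order. The hypothesis encodes
-- j = m + 1 - k without truncated subtraction.
e≡∣s∣ : ∀ m j k → j + k ≡ suc m → e m j ≡ ∣s∣ (suc m) k
e≡∣s∣ m       zero    k       refl = sym (∣s∣[n,n]≡1 (suc m))
e≡∣s∣ m       (suc j) zero    eq   =
  trans (e≡0 (ℕₚ.≤-reflexive (trans (sym eq) (cong suc (ℕₚ.+-identityʳ j)))))
        (sym (∣s∣[1+n,0]≡0 m))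
e≡∣s∣ zero    (suc zero)    (suc k) ()
e≡∣s∣ zero    (suc (suc j)) (suc k) ()
e≡∣s∣ (suc m) (suc j) (suc k) eq   = trans
  (cong₂ (λ a b → suc m ℕ.* a + b)
    (e≡∣s∣ m j (suc k) (ℕₚ.suc-injective eq))
    (e≡∣s∣ m (suc j) k (trans (sym (ℕₚ.+-suc j k)) (ℕₚ.suc-injective eq))))
  (ℕₚ.+-comm _ (∣s∣ (suc m) k))

-- The two sums

-- Products of fractions can thus be computed before reduction to lowest terms; `toℚᵘ` is injective
-- and respects multiplication.
fromℚᵘ-homo-* : ∀ p q → fromℚᵘ (p ℚᵘ.* q) ≡ fromℚᵘ p * fromℚᵘ q
fromℚᵘ-homo-* p q = ℚₚ.toℚᵘ-injective (begin
  toℚᵘ (fromℚᵘ (p ℚᵘ.* q))                ≈⟨ ℚₚ.toℚᵘ-fromℚᵘ (p ℚᵘ.* q) ⟩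
  p ℚᵘ.* q                                ≈⟨ ℚᵘₚ.*-cong (ℚₚ.toℚᵘ-fromℚᵘ p) (ℚₚ.toℚᵘ-fromℚᵘ q) ⟨
  toℚᵘ (fromℚᵘ p) ℚᵘ.* toℚᵘ (fromℚᵘ q)    ≈⟨ ℚₚ.toℚᵘ-homo-* (fromℚᵘ p) (fromℚᵘ q) ⟨
  toℚᵘ (fromℚᵘ p * fromℚᵘ q)              ∎)
  where open import Relation.Binary.Reasoning.Setoid ℚᵘₚ.≃-setoid

fromℚᵘ-homo-+ : ∀ p q → fromℚᵘ (p ℚᵘ.+ q) ≡ fromℚᵘ p ℚ.+ fromℚᵘ q
fromℚᵘ-homo-+ p q = ℚₚ.toℚᵘ-injective (begin
  toℚᵘ (fromℚᵘ (p ℚᵘ.+ q))                ≈⟨ ℚₚ.toℚᵘ-fromℚᵘ (p ℚᵘ.+ q) ⟩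
  p ℚᵘ.+ q                                ≈⟨ ℚᵘₚ.+-cong (ℚₚ.toℚᵘ-fromℚᵘ p) (ℚₚ.toℚᵘ-fromℚᵘ q) ⟨
  toℚᵘ (fromℚᵘ p) ℚᵘ.+ toℚᵘ (fromℚᵘ q)    ≈⟨ ℚₚ.toℚᵘ-homo-+ (fromℚᵘ p) (fromℚᵘ q) ⟨
  toℚᵘ (fromℚᵘ p ℚ.+ fromℚᵘ q)            ∎)
  where open import Relation.Binary.Reasoning.Setoid ℚᵘₚ.≃-setoid

fromℤ-homo-* : ∀ a b → fromℤ (a ℤ.* b) ≡ fromℤ a * fromℤ b
fromℤ-homo-* a b = fromℚᵘ-homo-* (mkℚᵘ a 0) (mkℚᵘ b 0)

fromℤ-homo-+ : ∀ a b → fromℤ (a ℤ.+ b) ≡ fromℤ a ℚ.+ fromℤ b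
fromℤ-homo-+ a b = trans
  (ℚₚ.fromℚᵘ-cong {mkℚᵘ (a ℤ.+ b) 0} {mkℚᵘ a 0 ℚᵘ.+ mkℚᵘ b 0}
    (*≡* (cong (ℤ._* 1ℤ) (sym (cong₂ ℤ._+_ (ℤₚ.*-identityʳ a) (ℤₚ.*-identityʳ b))))))
  (fromℚᵘ-homo-+ (mkℚᵘ a 0) (mkℚᵘ b 0))

fromℕ : ℕ → ℚ
fromℕ n = fromℤ (+ n)

fromℕ-homo-* : ∀ a b → fromℕ (a ℕ.* b) ≡ fromℕ a * fromℕ b
fromℕ-homo-* a b = trans (cong fromℤ (ℤₚ.pos-* a b)) (fromℤ-homo-* (+ a) (+ b))

fromℕ-homo-+ : ∀ a b → fromℕ (a + b) ≡ fromℕ a ℚ.+ fromℕ b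
fromℕ-homo-+ a b = fromℤ-homo-+ (+ a) (+ b)

*-cancel-1/ : ∀ a b .{{_ : NonZero b}} .{{_ : NonZero (suc a ℕ.* b)}} →
  fromℕ (suc a) * (+ 1 ℚ./ (suc a ℕ.* b)) ≡ + 1 ℚ./ b
*-cancel-1/ a b@(suc b-1) = trans
  -- `mkℚᵘ` takes the denominator minus one; `b-1 + a ℕ.* b` is the predecessor of `suc a ℕ.* b`.
  (sym (fromℚᵘ-homo-* (mkℚᵘ (+ suc a) 0) (mkℚᵘ (+ 1) (b-1 + a ℕ.* b))))
  (ℚₚ.fromℚᵘ-cong {mkℚᵘ (+ suc a) 0 ℚᵘ.* mkℚᵘ (+ 1) (b-1 + a ℕ.* b)} {mkℚᵘ (+ 1) b-1}
    (*≡* (cong +_ (solve 2 (λ a b → (a :* con 1) :* b := con 1 :* (con 1 :* (a :* b)))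
                     refl (suc a) b))))
  where open ℕSolver.+-*-Solver

sum-++ : ∀ xs ys → sum (xs ++ ys) ≡ sum xs ℚ.+ sum ys
sum-++ []       ys = sym (ℚₚ.+-identityˡ _)
sum-++ (x ∷ xs) ys = trans (cong (x ℚ.+_) (sum-++ xs ys)) (sym (ℚₚ.+-assoc x _ _))

-- The equation is asked for only on the listed elements, since the effect of `prepend` on `π`
-- depends on the bound on the parts.
*-sum-map : ∀ {a} {A : Set a} {f g : A → ℚ} r {xs} →
  All (λ x → r * f x ≡ g x) xs → r * sum (map f xs) ≡ sum (map g xs)
*-sum-map r [] = ℚₚ.*-zeroʳ r
*-sum-map r (eq ∷ eqs) = trans (ℚₚ.*-distribˡ-+ r _ _) (cong₂ ℚ._+_ eq (*-sum-map r eqs))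

∑ : (LinearPartition → ℚ) → ℕ → ℕ → ℚ
∑ f m j = sum (map f (distinct≤ m j))

∑-suc : ∀ f m j → ∑ f (suc m) (suc j) ≡
  sum (map (f ∘ prepend (suc m)) (distinct≤ m j)) ℚ.+ ∑ f m (suc j)
∑-suc f m j = begin
  sum (map f (map (prepend (suc m)) (distinct≤ m j) ++ distinct≤ m (suc j)))
    ≡⟨ cong sum (map-++ f (map (prepend (suc m)) (distinct≤ m j)) _) ⟩
  sum (map f (map (prepend (suc m)) (distinct≤ m j)) ++ map f (distinct≤ m (suc j)))
    ≡⟨ sum-++ (map f (map (prepend (suc m)) (distinct≤ m j))) _ ⟩
  sum (map f (map (prepend (suc m)) (distinct≤ m j))) ℚ.+ ∑ f m (suc j)
    ≡⟨ cong (λ xs → sum xs ℚ.+ ∑ f m (suc j)) (map-∘ (distinct≤ m j)) ⟨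
  sum (map (f ∘ prepend (suc m)) (distinct≤ m j)) ℚ.+ ∑ f m (suc j) ∎
  where open ≡-Reasoning

π-prepend : ∀ {m μ} → part μ 0 ≤ suc m → π (prepend (suc m) μ) ≡ suc m ℕ.* π μ
π-prepend {m} {μ} μ₀≤ = cong product (parts-prepend {m} {μ} μ₀≤)

-- A new top part `suc m` multiplies `π` by `suc m`, which is the recurrence defining `e`.
∑πℚ : ∀ m j → ∑ πℚ m j ≡ fromℕ (e m j)
∑πℚ m       zero    = refl
∑πℚ zero    (suc j) = refl
∑πℚ (suc m) (suc j) = begin
  ∑ πℚ (suc m) (suc j)
    ≡⟨ ∑-suc πℚ m j ⟩
  sum (map (πℚ ∘ prepend (suc m)) (distinct≤ m j)) ℚ.+ ∑ πℚ m (suc j)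
    ≡⟨ cong (ℚ._+ ∑ πℚ m (suc j)) (*-sum-map (fromℕ (suc m)) (All.map
         (λ {μ} (_ , _ , b) → sym (trans
           (cong fromℕ (π-prepend {m} {μ} (ℕₚ.<⇒≤ b)))
           (fromℕ-homo-* (suc m) (π μ))))
         (distinct≤-sound m j))) ⟨
  fromℕ (suc m) * ∑ πℚ m j ℚ.+ ∑ πℚ m (suc j)
    ≡⟨ cong₂ (λ a b → fromℕ (suc m) * a ℚ.+ b) (∑πℚ m j) (∑πℚ m (suc j)) ⟩
  fromℕ (suc m) * fromℕ (e m j) ℚ.+ fromℕ (e m (suc j))
    ≡⟨ cong (ℚ._+ fromℕ (e m (suc j))) (fromℕ-homo-* (suc m) (e m j)) ⟨
  fromℕ (suc m ℕ.* e m j) ℚ.+ fromℕ (e m (suc j))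
    ≡⟨ fromℕ-homo-+ (suc m ℕ.* e m j) (e m (suc j)) ⟨
  fromℕ (e (suc m) (suc j)) ∎
  where open ≡-Reasoning

*-π⁻¹-prepend : ∀ m μ → part μ 0 ≤ suc m →
  fromℕ (suc m) * π⁻¹ (prepend (suc m) μ) ≡ π⁻¹ μ
*-π⁻¹-prepend m μ μ₀≤ = trans
  (cong (fromℕ (suc m) *_) (ℚₚ./-cong {+ 1} {π (prepend (suc m) μ)} {+ 1} {suc m ℕ.* π μ}
    {{π≢0 (prepend (suc m) μ)}} {{nz}} refl (π-prepend {m} {μ} μ₀≤)))
  (*-cancel-1/ m (π μ) {{π≢0 μ}} {{nz}})
  where
  nz : NonZero (suc m ℕ.* π μ)
  nz = ℕₚ.m*n≢0 (suc m) (π μ) {{_}} {{π≢0 μ}}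

-- In (m + 1)! the factor m + 1 cancels against the top part in the first summand and survives as
-- the coefficient of the second, which is the recurrence for `∣s∣`.
m!*∑π⁻¹ : ∀ m k → fromℕ (m !) * ∑ π⁻¹ m k ≡ fromℕ (∣s∣ (suc m) (suc k))
m!*∑π⁻¹ m       zero    =
  trans (ℚₚ.*-identityʳ (fromℕ (m !))) (cong fromℕ (sym (∣s∣[1+n,1]≡n! m)))
m!*∑π⁻¹ zero    (suc k) = refl
m!*∑π⁻¹ (suc m) (suc k) = begin
  fromℕ (suc m ℕ.* m !) * ∑ π⁻¹ (suc m) (suc k)
    ≡⟨ cong₂ _*_ (fromℕ-homo-* (suc m) (m !)) (∑-suc π⁻¹ m k) ⟩
  fromℕ (suc m) * fromℕ (m !) * (A ℚ.+ ∑ π⁻¹ m (suc k))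
    ≡⟨ solve 4 (λ n f a b → n :* f :* (a :+ b) := f :* (n :* a) :+ n :* (f :* b)) refl
         (fromℕ (suc m)) (fromℕ (m !)) A (∑ π⁻¹ m (suc k)) ⟩
  fromℕ (m !) * (fromℕ (suc m) * A) ℚ.+ fromℕ (suc m) * (fromℕ (m !) * ∑ π⁻¹ m (suc k))
    ≡⟨ cong (λ a → fromℕ (m !) * a ℚ.+ fromℕ (suc m) * (fromℕ (m !) * ∑ π⁻¹ m (suc k)))
         (*-sum-map (fromℕ (suc m)) (All.map
           (λ {μ} (_ , _ , b) → *-π⁻¹-prepend m μ (ℕₚ.<⇒≤ b))
           (distinct≤-sound m k))) ⟩
  fromℕ (m !) * ∑ π⁻¹ m k ℚ.+ fromℕ (suc m) * (fromℕ (m !) * ∑ π⁻¹ m (suc k))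
    ≡⟨ cong₂ (λ a b → a ℚ.+ fromℕ (suc m) * b) (m!*∑π⁻¹ m k) (m!*∑π⁻¹ m (suc k)) ⟩
  fromℕ (∣s∣ (suc m) (suc k)) ℚ.+ fromℕ (suc m) * fromℕ (∣s∣ (suc m) (suc (suc k)))
    ≡⟨ cong (fromℕ (∣s∣ (suc m) (suc k)) ℚ.+_) (fromℕ-homo-* (suc m) (∣s∣ (suc m) (suc (suc k)))) ⟨
  fromℕ (∣s∣ (suc m) (suc k)) ℚ.+ fromℕ (suc m ℕ.* ∣s∣ (suc m) (suc (suc k)))
    ≡⟨ fromℕ-homo-+ (∣s∣ (suc m) (suc k)) (suc m ℕ.* ∣s∣ (suc m) (suc (suc k))) ⟨
  fromℕ (∣s∣ (suc (suc m)) (suc (suc k))) ∎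
  where
  open ≡-Reasoning
  open ℚSolver.+-*-Solver
  A = sum (map (π⁻¹ ∘ prepend (suc m)) (distinct≤ m k))

isSum-π⁻¹ : ∀ k m → ∃[ A ] IsSum (DistinctBelow (+ k ℤ.- + 1) (suc m)) π⁻¹ A ×
  fromℕ (m !) * A ≡ fromℕ (∣s∣ (suc m) k)
-- For k = 0 the required number of parts is -1, so the sum is empty, matching the vanishing
-- constant term.
isSum-π⁻¹ zero    m = 0ℚ , isSum-empty (λ { _ (_ , () , _) })
  , trans (ℚₚ.*-zeroʳ (fromℕ (m !))) (cong fromℕ (sym (∣s∣[1+n,0]≡0 m)))
isSum-π⁻¹ (suc k) m = ∑ π⁻¹ m k
  , enumerates⇒isSum (λ {μ} {ν} → π⁻¹-cong {μ} {ν}) (distinct≤-enumerates m k)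
  , m!*∑π⁻¹ m k

isSum-πℚ : ∀ k m →
  IsSum (DistinctBelow (+ suc m ℤ.- + k) (suc m)) πℚ (fromℕ (∣s∣ (suc m) k))
isSum-πℚ k m with k ℕ.≤? suc m
... | yes k≤n = subst (λ i → IsSum (DistinctBelow i (suc m)) πℚ (fromℕ (∣s∣ (suc m) k)))
  (sym (trans (ℤₚ.m-n≡m⊖n (suc m) k) (ℤₚ.⊖-≥ k≤n)))
  (subst (IsSum (DistinctBelow (+ (suc m ∸ k)) (suc m)) πℚ)
    (trans (∑πℚ m (suc m ∸ k)) (cong fromℕ (e≡∣s∣ m (suc m ∸ k) k (ℕₚ.m∸n+n≡m k≤n))))
    (enumerates⇒isSum (λ {μ} {ν} → πℚ-cong {μ} {ν}) (distinct≤-enumerates m (suc m ∸ k))))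
-- Here n - k is negative, so no partition qualifies, and the degree of (y)ₙ is less than k.
... | no k≰n = subst (λ a → IsSum (DistinctBelow (+ suc m ℤ.- + k) (suc m)) πℚ (fromℕ a))
  (sym (∣s∣≡0 (ℕₚ.≰⇒> k≰n)))
  (isSum-empty λ μ (_ , l , _) → k≰n (ℤₚ.drop‿+≤+ (ℤₚ.0≤i-j⇒j≤i (subst (0ℤ ℤ.≤_) l (ℤ.+≤+ z≤n)))))

proposition2p7 : (k n : ℕ) .{{_ : NonZero n}} →
    ∃[ A ] ∃[ B ]
    IsSum (DistinctBelow (+ k ℤ.- + 1) n) π⁻¹ A ×
    IsSum (DistinctBelow (+ n ℤ.- + k) n) πℚ B ×
    fromℤ (s n k) ≡ sign (n + k) * fromℤ (+ ((n ∸ 1) !)) * A ×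
    sign (n + k) * fromℤ (+ ((n ∸ 1) !)) * A ≡ sign (n + k) * B
proposition2p7 k n@(suc m) =
  let A , isSum-A , m!*A≡ = isSum-π⁻¹ k m
      second = trans (ℚₚ.*-assoc (sign (n + k)) (fromℕ (m !)) A) (cong (sign (n + k) *_) m!*A≡)
  -- Both (n - 1)! `A` and `B` equal c(n, k), and the sign is the one relating c(n, k) to `s n k`.
  in A , fromℕ (∣s∣ n k) , isSum-A , isSum-πℚ k m
   , trans (trans (cong fromℤ (s≡±∣s∣ n k)) (fromℤ-homo-* ((ℤ.- 1ℤ) ℤ.^ (n + k)) (+ ∣s∣ n k)))
       (sym second)
   , second
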